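{- Let $\{a_n\}_{n\ge 0}$ be a sequence of real numbers, let \[ t(x,y)=4(1-x)(1-y)-(1-xy)^2 \quad\text{and}\quad u_n=\frac{a_{n-1}a_{n+1}}{a_n^2}. \] Suppose there exist an integer $N\ge 1$ (with $a_n\ne 0$ for all $n\ge N$) and real sequences $f_n$, $g_n$ such that for all $n\ge N$, \[ g_n<u_n<f_n \] and \[ t(g_n,g_{n+1})>0,\quad t(g_n,f_{n+1})>0,\quad t(f_n,g_{n+1})>0,\quad t(f_n,f_{n+1})>0. \] Then $\{a_n\}_{n\ge N}$ satisfies the higher order Turán inequality.
   Context: The sequence $\{a_n\}_{n\ge N}$ is said to satisfy the higher order Turán inequality if for all $n\ge N+1$, \[ 4(a_n^2-a_{n-1}a_{n+1})(a_{n+1}^2-a_na_{n+2})-(a_na_{n+1}-a_{n-1}a_{n+2})^2\ge 0. \] -}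

module Defs where

open import Data.Integer using (+_)
open import Data.Nat using (ℕ; suc; _∸_; _⊔_)
import Data.Nat as ℕ
import Data.Nat.Properties as ℕP
open import Data.Product using (_×_; _,_; ∃-syntax)
open import Data.Rational using (ℚ; 0ℚ; 1ℚ)
import Data.Rational as ℚ
import Data.Rational.Properties as ℚP
open import Data.Rational.Solver using (module +-*-Solver)
open import Data.Sum using (_⊎_; inj₁; inj₂)
open import Relation.Binary.PropositionalEquality
  using (_≡_; _≢_; refl; sym; trans; cong; cong₂; subst; subst₂)
open import Relation.Nullary using (yes; no; contradiction)

infix  4 _<_ _≤_ _≃_ _#_
infixl 6 _+_ _-_
infixl 7 _*_
infix  8 _² -_

-- The real numbers are Cauchy sequences of rationals, considered up to _≃_
-- (ℝ is used as a setoid: its elements are representatives).  The arithmetic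
-- operations act termwise.

IsCauchy : (ℕ → ℚ) → Set
IsCauchy x = ∀ ε → 0ℚ ℚ.< ε →
  ∃[ K ] ∀ m n → K ℕ.≤ m → K ℕ.≤ n → ℚ.∣ x m ℚ.- x n ∣ ℚ.< ε

record ℝ : Set where
  constructor mkℝ
  field
    seq    : ℕ → ℚ
    cauchy : IsCauchy seq

open ℝ public

Eventually : (ℕ → Set) → Set
Eventually P = ∃[ K ] ∀ n → K ℕ.≤ n → P n

_≃_ : ℝ → ℝ → Set
x ≃ y = ∀ ε → 0ℚ ℚ.< ε → Eventually λ n → ℚ.∣ seq x n ℚ.- seq y n ∣ ℚ.< ε

_<_ : ℝ → ℝ → Set
x < y = ∃[ ε ] (0ℚ ℚ.< ε × Eventually λ n → seq x n ℚ.+ ε ℚ.< seq y n)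

_≤_ : ℝ → ℝ → Set
x ≤ y = ∀ ε → 0ℚ ℚ.< ε → Eventually λ n → seq x n ℚ.< seq y n ℚ.+ ε

-- Apartness: the constructive form of x ≠ y, and what division requires.
_#_ : ℝ → ℝ → Set
x # y = x < y ⊎ y < x

0<+ : ∀ {p q} → 0ℚ ℚ.< p → 0ℚ ℚ.< q → 0ℚ ℚ.< p ℚ.+ q
0<+ 0<p 0<q = ℚP.+-mono-< 0<p 0<q

0<* : ∀ {p q} → 0ℚ ℚ.< p → 0ℚ ℚ.< q → 0ℚ ℚ.< p ℚ.* q
0<* {p} {q} 0<p 0<q = subst (ℚ._< p ℚ.* q) (ℚP.*-zeroʳ p)
  (ℚP.*-monoʳ-<-pos p {{ℚ.positive 0<p}} 0<q)

*-mono-≤ : ∀ {p q r s} → 0ℚ ℚ.≤ p → p ℚ.≤ q → 0ℚ ℚ.≤ r → r ℚ.≤ s →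
           p ℚ.* r ℚ.≤ q ℚ.* s
*-mono-≤ {p} {q} {r} {s} 0≤p p≤q 0≤r r≤s = ℚP.≤-trans
  (ℚP.*-monoʳ-≤-nonNeg r {{ℚ.nonNegative 0≤r}} p≤q)
  (ℚP.*-monoˡ-≤-nonNeg q {{ℚ.nonNegative (ℚP.≤-trans 0≤p p≤q)}} r≤s)

split : ∀ b ε → 0ℚ ℚ.< b → 0ℚ ℚ.< ε → ∃[ δ ] (0ℚ ℚ.< δ × b ℚ.* δ ≡ ε)
split b ε 0<b 0<ε = (1/b ℚ.* ε) , 0<* {1/b} {ε} 0<1/b 0<ε ,
  trans (sym (ℚP.*-assoc b 1/b ε))
        (trans (cong (ℚ._* ε) (ℚP.*-inverseʳ b)) (ℚP.*-identityˡ ε))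
  where
  instance
    b-pos : ℚ.Positive b
    b-pos = ℚ.positive 0<b
    b-nz : ℚ.NonZero b
    b-nz = ℚP.pos⇒nonZero b
  1/b : ℚ
  1/b = ℚ.1/ b
  0<1/b : 0ℚ ℚ.< 1/b
  0<1/b = ℚP.positive⁻¹ 1/b {{ℚP.1/pos⇒pos b}}

bounded : ∀ {x} → IsCauchy x →
          ∃[ b ] (0ℚ ℚ.< b × Eventually λ n → ℚ.∣ x n ∣ ℚ.≤ b)
bounded {x} cx with cx 1ℚ (ℚP.positive⁻¹ 1ℚ)
... | K , h = (1ℚ ℚ.+ ℚ.∣ x K ∣)
            , ℚP.+-mono-<-≤ (ℚP.positive⁻¹ 1ℚ) (ℚP.0≤∣p∣ (x K))
            , K , λ n K≤n → ℚP.≤-trans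
                (subst (λ z → ℚ.∣ z ∣ ℚ.≤ ℚ.∣ x n ℚ.- x K ∣ ℚ.+ ℚ.∣ x K ∣)
                   (lem (x n) (x K)) (ℚP.∣p+q∣≤∣p∣+∣q∣ (x n ℚ.- x K) (x K)))
                (ℚP.+-monoˡ-≤ ℚ.∣ x K ∣ (ℚP.<⇒≤ (h n K K≤n ℕP.≤-refl)))
  where
  open +-*-Solver
  lem : ∀ p q → (p ℚ.- q) ℚ.+ q ≡ p
  lem = solve 2 (λ p q → (p :- q) :+ q := p) refl

const-cauchy : ∀ q → IsCauchy (λ _ → q)
const-cauchy q ε 0<ε = 0 , λ _ _ _ _ →
  subst (λ z → ℚ.∣ z ∣ ℚ.< ε) (sym (ℚP.+-inverseʳ q)) 0<ε

neg-cauchy : ∀ {x} → IsCauchy x → IsCauchy (λ n → ℚ.- x n)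
neg-cauchy {x} cx ε 0<ε with cx ε 0<ε
... | K , h = K , λ m n K≤m K≤n →
  subst (ℚ._< ε)
    (trans (sym (ℚP.∣-p∣≡∣p∣ (x m ℚ.- x n))) (cong ℚ.∣_∣ (lem (x m) (x n))))
    (h m n K≤m K≤n)
  where
  open +-*-Solver
  lem : ∀ p q → ℚ.- (p ℚ.- q) ≡ (ℚ.- p) ℚ.- (ℚ.- q)
  lem = solve 2 (λ p q → :- (p :- q) := (:- p) :- (:- q)) refl

+-cauchy : ∀ {x y} → IsCauchy x → IsCauchy y → IsCauchy (λ n → x n ℚ.+ y n)
+-cauchy {x} {y} cx cy ε 0<ε
  with split (1ℚ ℚ.+ 1ℚ) ε (ℚP.positive⁻¹ (1ℚ ℚ.+ 1ℚ)) 0<ε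
... | δ , 0<δ , eq with cx δ 0<δ | cy δ 0<δ
... | K , h | L , k = K ⊔ L , λ m n M≤m M≤n →
  subst₂ (λ z e → ℚ.∣ z ∣ ℚ.< e) (lem (x m) (y m) (x n) (y n))
    (trans (two δ) eq)
    (ℚP.≤-<-trans (ℚP.∣p+q∣≤∣p∣+∣q∣ (x m ℚ.- x n) (y m ℚ.- y n))
      (ℚP.+-mono-<
        (h m n (ℕP.m⊔n≤o⇒m≤o K L M≤m) (ℕP.m⊔n≤o⇒m≤o K L M≤n))
        (k m n (ℕP.m⊔n≤o⇒n≤o K L M≤m) (ℕP.m⊔n≤o⇒n≤o K L M≤n))))
  where
  open +-*-Solver
  lem : ∀ p q r s → (p ℚ.- r) ℚ.+ (q ℚ.- s) ≡ (p ℚ.+ q) ℚ.- (r ℚ.+ s)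
  lem = solve 4 (λ p q r s → (p :- r) :+ (q :- s) := (p :+ q) :- (r :+ s)) refl
  two : ∀ d → d ℚ.+ d ≡ (1ℚ ℚ.+ 1ℚ) ℚ.* d
  two = solve 1 (λ d → d :+ d := (con 1ℚ :+ con 1ℚ) :* d) refl

prod-bound : ∀ p q b d → ℚ.∣ p ∣ ℚ.≤ b → ℚ.∣ q ∣ ℚ.≤ d →
             ℚ.∣ p ℚ.* q ∣ ℚ.≤ b ℚ.* d
prod-bound p q b d p≤b q≤d =
  subst (ℚ._≤ b ℚ.* d) (sym (ℚP.∣p*q∣≡∣p∣*∣q∣ p q))
    (*-mono-≤ {ℚ.∣ p ∣} {b} {ℚ.∣ q ∣} {d} (ℚP.0≤∣p∣ p) p≤b (ℚP.0≤∣p∣ q) q≤d)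

prod-close : ∀ p q r s b c d → ℚ.∣ p ∣ ℚ.≤ b → ℚ.∣ s ∣ ℚ.≤ c →
             ℚ.∣ q ℚ.- s ∣ ℚ.≤ d → ℚ.∣ p ℚ.- r ∣ ℚ.≤ d →
             ℚ.∣ p ℚ.* q ℚ.- r ℚ.* s ∣ ℚ.≤ b ℚ.* d ℚ.+ c ℚ.* d
prod-close p q r s b c d p≤b s≤c dq dp = begin
  ℚ.∣ p ℚ.* q ℚ.- r ℚ.* s ∣
    ≡⟨ cong ℚ.∣_∣ (lem p q r s) ⟩
  ℚ.∣ p ℚ.* (q ℚ.- s) ℚ.+ s ℚ.* (p ℚ.- r) ∣
    ≤⟨ ℚP.∣p+q∣≤∣p∣+∣q∣ (p ℚ.* (q ℚ.- s)) (s ℚ.* (p ℚ.- r)) ⟩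
  ℚ.∣ p ℚ.* (q ℚ.- s) ∣ ℚ.+ ℚ.∣ s ℚ.* (p ℚ.- r) ∣
    ≤⟨ ℚP.+-mono-≤ (prod-bound p (q ℚ.- s) b d p≤b dq)
                   (prod-bound s (p ℚ.- r) c d s≤c dp) ⟩
  b ℚ.* d ℚ.+ c ℚ.* d ∎
  where
  open ℚP.≤-Reasoning
  open +-*-Solver
  lem : ∀ p q r s →
    p ℚ.* q ℚ.- r ℚ.* s ≡ p ℚ.* (q ℚ.- s) ℚ.+ s ℚ.* (p ℚ.- r)
  lem = solve 4 (λ p q r s →
    p :* q :- r :* s := p :* (q :- s) :+ s :* (p :- r)) refl

split₂ : ∀ b c ε → 0ℚ ℚ.< b → 0ℚ ℚ.< c → 0ℚ ℚ.< ε →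
         ∃[ δ ] (0ℚ ℚ.< δ × b ℚ.* δ ℚ.+ c ℚ.* δ ℚ.< ε)
split₂ b c ε 0<b 0<c 0<ε =
  let ε′ , 0<ε′ , ε′<ε = ℚP.<-dense {0ℚ} {ε} 0<ε
      δ , 0<δ , eq = split (b ℚ.+ c) ε′ (0<+ {b} {c} 0<b 0<c) 0<ε′
  in δ , 0<δ , subst (ℚ._< ε) (trans (sym eq) (ℚP.*-distribʳ-+ δ b c)) ε′<ε

*-cauchy : ∀ {x y} → IsCauchy x → IsCauchy y → IsCauchy (λ n → x n ℚ.* y n)
*-cauchy {x} {y} cx cy ε 0<ε =
  let b , 0<b , I , bx = bounded {x} cx
      c , 0<c , J , by = bounded {y} cy
      δ , 0<δ , small = split₂ b c ε 0<b 0<c 0<ε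
      K , h = cx δ 0<δ
      L , k = cy δ 0<δ
  in (I ⊔ J) ⊔ (K ⊔ L) , λ m n M≤m M≤n →
    let IJ≤m = ℕP.m⊔n≤o⇒m≤o (I ⊔ J) (K ⊔ L) M≤m
        IJ≤n = ℕP.m⊔n≤o⇒m≤o (I ⊔ J) (K ⊔ L) M≤n
        KL≤m = ℕP.m⊔n≤o⇒n≤o (I ⊔ J) (K ⊔ L) M≤m
        KL≤n = ℕP.m⊔n≤o⇒n≤o (I ⊔ J) (K ⊔ L) M≤n
    in ℚP.≤-<-trans
      (prod-close (x m) (y m) (x n) (y n) b c δ
        (bx m (ℕP.m⊔n≤o⇒m≤o I J IJ≤m)) (by n (ℕP.m⊔n≤o⇒n≤o I J IJ≤n))
        (ℚP.<⇒≤ (k m n (ℕP.m⊔n≤o⇒n≤o K L KL≤m) (ℕP.m⊔n≤o⇒n≤o K L KL≤n)))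
        (ℚP.<⇒≤ (h m n (ℕP.m⊔n≤o⇒m≤o K L KL≤m) (ℕP.m⊔n≤o⇒m≤o K L KL≤n))))
      small

fromℚ : ℚ → ℝ
fromℚ q = mkℝ (λ _ → q) (const-cauchy q)

0ℝ 1ℝ 4ℝ : ℝ
0ℝ = fromℚ 0ℚ
1ℝ = fromℚ 1ℚ
4ℝ = fromℚ (+ 4 ℚ./ 1)

_+_ : ℝ → ℝ → ℝ
x + y = mkℝ (λ n → seq x n ℚ.+ seq y n)
  (+-cauchy {seq x} {seq y} (cauchy x) (cauchy y))

-_ : ℝ → ℝ
- x = mkℝ (λ n → ℚ.- seq x n) (neg-cauchy {seq x} (cauchy x))

_-_ : ℝ → ℝ → ℝ
x - y = x + (- y)

_*_ : ℝ → ℝ → ℝ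
x * y = mkℝ (λ n → seq x n ℚ.* seq y n)
  (*-cauchy {seq x} {seq y} (cauchy x) (cauchy y))

_² : ℝ → ℝ
x ² = x * x

-- Totalised inverse on ℚ.  A sequence representing a real apart from 0 may
-- still have finitely many zero terms, whose inverses are irrelevant.
recip : ℚ → ℚ
recip p with p ℚP.≟ 0ℚ
... | yes _  = 0ℚ
... | no p≢0 = ℚ.1/_ p {{ℚ.≢-nonZero p≢0}}

*-recip : ∀ p → p ≢ 0ℚ → p ℚ.* recip p ≡ 1ℚ
*-recip p p≢0 with p ℚP.≟ 0ℚ
... | yes p≡0 = contradiction p≡0 p≢0
... | no p≢0′ = ℚP.*-inverseʳ p {{ℚ.≢-nonZero p≢0′}}

η≤⇒≢0 : ∀ {η p} → 0ℚ ℚ.< η → η ℚ.≤ ℚ.∣ p ∣ → p ≢ 0ℚ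
η≤⇒≢0 0<η η≤p refl = ℚP.<-irrefl refl (ℚP.<-≤-trans 0<η η≤p)

away : ∀ {x} → x # 0ℝ →
       ∃[ η ] (0ℚ ℚ.< η × Eventually λ n → η ℚ.≤ ℚ.∣ seq x n ∣)
away {x} (inj₁ (ε , 0<ε , K , h)) = ε , 0<ε , K , λ n K≤n →
  ℚP.≤-trans
    (subst₂ ℚ._≤_ (lem (seq x n) ε) (ℚP.+-identityʳ (ℚ.- seq x n))
      (ℚP.+-monoʳ-≤ (ℚ.- seq x n) (ℚP.<⇒≤ (h n K≤n))))
    (subst (ℚ.- seq x n ℚ.≤_) (ℚP.∣-p∣≡∣p∣ (seq x n)) (p≤∣p∣ (ℚ.- seq x n)))
  where
  open +-*-Solver
  lem : ∀ p e → (ℚ.- p) ℚ.+ (p ℚ.+ e) ≡ e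
  lem = solve 2 (λ p e → (:- p) :+ (p :+ e) := e) refl
  p≤∣p∣ : ∀ p → p ℚ.≤ ℚ.∣ p ∣
  p≤∣p∣ p with ℚP.≤-total 0ℚ p
  ... | inj₁ 0≤p = ℚP.≤-reflexive (sym (ℚP.0≤p⇒∣p∣≡p 0≤p))
  ... | inj₂ p≤0 = ℚP.≤-trans p≤0 (ℚP.0≤∣p∣ p)
away {x} (inj₂ (ε , 0<ε , K , h)) = ε , 0<ε , K , λ n K≤n →
  let ε<x = subst (ℚ._< seq x n) (ℚP.+-identityˡ ε) (h n K≤n)
  in subst (ε ℚ.≤_)
       (sym (ℚP.0≤p⇒∣p∣≡p (ℚP.<⇒≤ (ℚP.<-trans 0<ε ε<x)))) (ℚP.<⇒≤ ε<x)

recip-diff : ∀ p q → p ≢ 0ℚ → q ≢ 0ℚ →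
             (recip p ℚ.- recip q) ℚ.* (q ℚ.* p) ≡ q ℚ.- p
recip-diff p q p≢0 q≢0 = trans (lem p q (recip p) (recip q))
  (cong₂ ℚ._-_
    (trans (cong (ℚ._* q) (*-recip p p≢0)) (ℚP.*-identityˡ q))
    (trans (cong (ℚ._* p) (*-recip q q≢0)) (ℚP.*-identityˡ p)))
  where
  open +-*-Solver
  lem : ∀ p q r s → (r ℚ.- s) ℚ.* (q ℚ.* p) ≡
                    (p ℚ.* r) ℚ.* q ℚ.- (q ℚ.* s) ℚ.* p
  lem = solve 4 (λ p q r s →
    (r :- s) :* (q :* p) := (p :* r) :* q :- (q :* s) :* p) refl

recip-close : ∀ p q η ε → 0ℚ ℚ.< η → η ℚ.≤ ℚ.∣ p ∣ → η ℚ.≤ ℚ.∣ q ∣ →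
              ℚ.∣ q ℚ.- p ∣ ℚ.< ε ℚ.* (η ℚ.* η) →
              ℚ.∣ recip p ℚ.- recip q ∣ ℚ.< ε
recip-close p q η ε 0<η η≤p η≤q q-p = ℚP.*-cancelʳ-<-nonNeg (η ℚ.* η)
  {{ℚ.nonNegative (ℚP.<⇒≤ (0<* {η} {η} 0<η 0<η))}} {D} {ε} (begin-strict
    D ℚ.* (η ℚ.* η)
      ≤⟨ ℚP.*-monoˡ-≤-nonNeg D {{ℚ.nonNegative (ℚP.0≤∣p∣ (recip p ℚ.- recip q))}}
           (*-mono-≤ {η} {ℚ.∣ q ∣} {η} {ℚ.∣ p ∣}
             (ℚP.<⇒≤ 0<η) η≤q (ℚP.<⇒≤ 0<η) η≤p) ⟩
    D ℚ.* (ℚ.∣ q ∣ ℚ.* ℚ.∣ p ∣)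
      ≡⟨ cong (D ℚ.*_) (sym (ℚP.∣p*q∣≡∣p∣*∣q∣ q p)) ⟩
    D ℚ.* ℚ.∣ q ℚ.* p ∣
      ≡⟨ sym (ℚP.∣p*q∣≡∣p∣*∣q∣ (recip p ℚ.- recip q) (q ℚ.* p)) ⟩
    ℚ.∣ (recip p ℚ.- recip q) ℚ.* (q ℚ.* p) ∣
      ≡⟨ cong ℚ.∣_∣ (recip-diff p q (η≤⇒≢0 0<η η≤p) (η≤⇒≢0 0<η η≤q)) ⟩
    ℚ.∣ q ℚ.- p ∣
      <⟨ q-p ⟩
    ε ℚ.* (η ℚ.* η) ∎)
  where
  open ℚP.≤-Reasoning
  D : ℚ
  D = ℚ.∣ recip p ℚ.- recip q ∣

recip-cauchy : ∀ {x} → x # 0ℝ → IsCauchy (λ n → recip (seq x n))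
recip-cauchy {x} x#0 ε 0<ε with away {x} x#0
... | η , 0<η , I , bx
  with cauchy x (ε ℚ.* (η ℚ.* η))
         (0<* {ε} {η ℚ.* η} 0<ε (0<* {η} {η} 0<η 0<η))
... | K , h = I ⊔ K , λ m n M≤m M≤n →
  recip-close (seq x m) (seq x n) η ε 0<η
    (bx m (ℕP.m⊔n≤o⇒m≤o I K M≤m)) (bx n (ℕP.m⊔n≤o⇒m≤o I K M≤n))
    (h n m (ℕP.m⊔n≤o⇒n≤o I K M≤n) (ℕP.m⊔n≤o⇒n≤o I K M≤m))

inverse : (x : ℝ) → x # 0ℝ → ℝ
inverse x x#0 = mkℝ (λ n → recip (seq x n)) (recip-cauchy {x} x#0)

*-inverseʳ : ∀ x (x#0 : x # 0ℝ) → x * inverse x x#0 ≃ 1ℝ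
*-inverseʳ x x#0 ε 0<ε with away {x} x#0
... | η , 0<η , K , h = K , λ n K≤n →
  subst (λ z → ℚ.∣ z ℚ.- 1ℚ ∣ ℚ.< ε)
    (sym (*-recip (seq x n) (η≤⇒≢0 0<η (h n K≤n)))) 0<ε

divide : (x y : ℝ) → y # 0ℝ → ℝ
divide x y y#0 = x * inverse y y#0

η²≤p² : ∀ η p → 0ℚ ℚ.< η → η ℚ.≤ ℚ.∣ p ∣ → η ℚ.* η ℚ.≤ p ℚ.* p
η²≤p² η p 0<η η≤p = subst (η ℚ.* η ℚ.≤_) (sq p)
  (*-mono-≤ {η} {ℚ.∣ p ∣} {η} {ℚ.∣ p ∣} (ℚP.<⇒≤ 0<η) η≤p (ℚP.<⇒≤ 0<η) η≤p)
  where
  open +-*-Solver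
  neg² : ∀ p → (ℚ.- p) ℚ.* (ℚ.- p) ≡ p ℚ.* p
  neg² = solve 1 (λ p → (:- p) :* (:- p) := p :* p) refl
  sq : ∀ p → ℚ.∣ p ∣ ℚ.* ℚ.∣ p ∣ ≡ p ℚ.* p
  sq p with ℚP.∣p∣≡p∨∣p∣≡-p p
  ... | inj₁ e = cong₂ ℚ._*_ e e
  ... | inj₂ e = trans (cong₂ ℚ._*_ e e) (neg² p)

²-#0 : ∀ {x} → x # 0ℝ → x ² # 0ℝ
²-#0 {x} x#0 with away {x} x#0
... | η , 0<η , K , h with ℚP.<-dense (0<* {η} {η} 0<η 0<η)
... | δ , 0<δ , δ<η² = inj₂ (δ , 0<δ , K , λ n K≤n →
  subst (ℚ._< seq x n ℚ.* seq x n) (sym (ℚP.+-identityˡ δ))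
    (ℚP.<-≤-trans δ<η² (η²≤p² η (seq x n) 0<η (h n K≤n))))

t : ℝ → ℝ → ℝ
t x y = 4ℝ * (1ℝ - x) * (1ℝ - y) - (1ℝ - x * y) ²

-- aₙ₋₁ is written a (n ∸ 1); below, u and the inequality are only used for n ≥ 1.
u : (a : ℕ → ℝ) (n : ℕ) → a n # 0ℝ → ℝ
u a n aₙ#0 = divide (a (n ∸ 1) * a (suc n)) (a n ²) (²-#0 {a n} aₙ#0)

HigherOrderTurán : ℕ → (ℕ → ℝ) → Set
HigherOrderTurán N a = ∀ n → suc N ℕ.≤ n →
  0ℝ ≤ 4ℝ * (a n ² - a (n ∸ 1) * a (suc n))
          * (a (suc n) ² - a n * a (suc (suc n)))
       - (a n * a (suc n) - a (n ∸ 1) * a (suc (suc n))) ²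

{-# OPTIONS --safe #-}
-- Up to the positive factor aₙ²aₙ₊₁², the higher order Turán expression is
-- t(uₙ,uₙ₊₁).  For fixed x, the function t(x,·) is a quadratic with leading
-- coefficient -x², hence concave, and t is symmetric; so positivity at the four
-- corners of the rectangle [gₙ,fₙ] × [gₙ₊₁,fₙ₊₁] propagates to its edges and then
-- to its interior.  Since the operations on ℝ act termwise, the argument takes
-- place in ℚ, at every sufficiently large index of the representing sequences.
module Submission where

open import Defs
open import Data.Integer using (+_)
open import Data.Nat using (ℕ; suc; _∸_; _⊔_)
open import Data.Product using (_×_; _,_)
import Data.Nat as ℕ
import Data.Nat.Properties as ℕP
open import Data.Rational using (ℚ; 0ℚ; 1ℚ)
import Data.Rational as ℚ
import Data.Rational.Properties as ℚP
open import Data.Rational.Solver using (module +-*-Solver)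
open import Data.Sum using (inj₁; inj₂)
open import Relation.Binary.PropositionalEquality
  using (_≡_; _≢_; refl; sym; trans; cong₂; subst; subst₂)

∩-eventually : {P Q : ℕ → Set} → Eventually P → Eventually Q →
               Eventually (λ k → P k × Q k)
∩-eventually (K , h) (L , h′) = K ⊔ L , λ k M≤k →
  h k (ℕP.m⊔n≤o⇒m≤o K L M≤k) , h′ k (ℕP.m⊔n≤o⇒n≤o K L M≤k)

map-eventually : {P Q : ℕ → Set} → (∀ k → P k → Q k) → Eventually P → Eventually Q
map-eventually φ (K , h) = K , λ k K≤k → φ k (h k K≤k)

p<p+ε : ∀ p {ε} → 0ℚ ℚ.< ε → p ℚ.< p ℚ.+ ε
p<p+ε p {ε} 0<ε =
  subst (ℚ._< p ℚ.+ ε) (ℚP.+-identityʳ p) (ℚP.+-monoʳ-< p 0<ε)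

<⇒eventually-< : ∀ x y → x < y → Eventually (λ k → seq x k ℚ.< seq y k)
<⇒eventually-< x y (ε , 0<ε , ev) =
  map-eventually (λ k → ℚP.<-trans (p<p+ε (seq x k) 0<ε)) ev

-- The slack `ε` in the definition of `≤` absorbs the step from weak to strict, so the termwise
-- argument only has to keep track of weak inequalities.
eventually-0≤⇒0≤ : ∀ x → Eventually (λ k → 0ℚ ℚ.≤ seq x k) → 0ℝ ≤ x
eventually-0≤⇒0≤ x ev ε 0<ε =
  map-eventually (λ k 0≤xₖ → ℚP.≤-<-trans 0≤xₖ (p<p+ε (seq x k) 0<ε)) ev

#0⇒eventually-≢0 : ∀ x → x # 0ℝ → Eventually (λ k → seq x k ≢ 0ℚ)
#0⇒eventually-≢0 x x#0 =
  let _ , 0<η , ev = away {x} x#0 in map-eventually (λ _ → η≤⇒≢0 0<η) ev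

0≤-+ : ∀ {p q} → 0ℚ ℚ.≤ p → 0ℚ ℚ.≤ q → 0ℚ ℚ.≤ p ℚ.+ q
0≤-+ = ℚP.+-mono-≤

0≤-* : ∀ {p q} → 0ℚ ℚ.≤ p → 0ℚ ℚ.≤ q → 0ℚ ℚ.≤ p ℚ.* q
0≤-* {p} {q} 0≤p 0≤q =
  *-mono-≤ {0ℚ} {p} {0ℚ} {q} ℚP.≤-refl 0≤p ℚP.≤-refl 0≤q

0≤p² : ∀ p → 0ℚ ℚ.≤ p ℚ.* p
0≤p² p with ℚP.≤-total 0ℚ p
... | inj₁ 0≤p = 0≤-* 0≤p 0≤p
... | inj₂ p≤0 = ℚP.nonNegative⁻¹ (p ℚ.* p)
  {{ℚP.nonPos*nonPos⇒nonPos p {{ℚ.nonPositive p≤0}} p {{ℚ.nonPositive p≤0}}}}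

p<q⇒0<q-p : ∀ {p q} → p ℚ.< q → 0ℚ ℚ.< q ℚ.- p
p<q⇒0<q-p {p} {q} p<q =
  subst (ℚ._< q ℚ.- p) (ℚP.+-inverseʳ p) (ℚP.+-monoˡ-< (ℚ.- p) p<q)

4ℚ : ℚ
4ℚ = + 4 ℚ./ 1

tℚ : ℚ → ℚ → ℚ
tℚ x y = 4ℚ ℚ.* (1ℚ ℚ.- x) ℚ.* (1ℚ ℚ.- y) ℚ.- (1ℚ ℚ.- x ℚ.* y) ℚ.* (1ℚ ℚ.- x ℚ.* y)

tℚ-comm : ∀ x y → tℚ x y ≡ tℚ y x
tℚ-comm = solve 2 (λ x y →
    con 4ℚ :* (con 1ℚ :- x) :* (con 1ℚ :- y)
      :- (con 1ℚ :- x :* y) :* (con 1ℚ :- x :* y)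
  := con 4ℚ :* (con 1ℚ :- y) :* (con 1ℚ :- x)
      :- (con 1ℚ :- y :* x) :* (con 1ℚ :- y :* x)) refl
  where open +-*-Solver

-- Concavity made exact: a quadratic with leading coefficient `-x²` exceeds its chord over `[l,h]`
-- at `v` by `x²(v-l)(h-v)`. Multiplying through by `h-l` keeps the identity free of division.
tℚ-interpolation : ∀ x l v h →
  (h ℚ.- v) ℚ.* tℚ x l ℚ.+ (v ℚ.- l) ℚ.* tℚ x h
    ℚ.+ (x ℚ.* x) ℚ.* ((v ℚ.- l) ℚ.* (h ℚ.- v) ℚ.* (h ℚ.- l))
  ≡ (h ℚ.- l) ℚ.* tℚ x v
tℚ-interpolation = solve 4 (λ x l v h →
  let t′ = λ x y → con 4ℚ :* (con 1ℚ :- x) :* (con 1ℚ :- y)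
                     :- (con 1ℚ :- x :* y) :* (con 1ℚ :- x :* y) in
  (h :- v) :* t′ x l :+ (v :- l) :* t′ x h
    :+ (x :* x) :* ((v :- l) :* (h :- v) :* (h :- l))
  := (h :- l) :* t′ x v) refl
  where open +-*-Solver

tℚ-between : ∀ x l v h → l ℚ.< v → v ℚ.< h →
             0ℚ ℚ.≤ tℚ x l → 0ℚ ℚ.≤ tℚ x h → 0ℚ ℚ.≤ tℚ x v
tℚ-between x l v h l<v v<h 0≤tl 0≤th =
  ℚP.*-cancelˡ-≤-pos (h ℚ.- l) {{ℚ.positive 0<h-l}}
    (subst₂ ℚ._≤_ (sym (ℚP.*-zeroʳ (h ℚ.- l))) (tℚ-interpolation x l v h)
      (0≤-+ (0≤-+ (0≤-* 0≤h-v 0≤tl) (0≤-* 0≤v-l 0≤th))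
            (0≤-* (0≤p² x) (0≤-* (0≤-* 0≤v-l 0≤h-v) (ℚP.<⇒≤ 0<h-l)))))
  where
  0<h-l : 0ℚ ℚ.< h ℚ.- l
  0<h-l = p<q⇒0<q-p (ℚP.<-trans l<v v<h)
  0≤v-l : 0ℚ ℚ.≤ v ℚ.- l
  0≤v-l = ℚP.<⇒≤ (p<q⇒0<q-p l<v)
  0≤h-v : 0ℚ ℚ.≤ h ℚ.- v
  0≤h-v = ℚP.<⇒≤ (p<q⇒0<q-p v<h)

tℚ-rectangle : ∀ {x y l h l′ h′} →
  l ℚ.< x → x ℚ.< h → l′ ℚ.< y → y ℚ.< h′ →
  0ℚ ℚ.≤ tℚ l l′ → 0ℚ ℚ.≤ tℚ l h′ → 0ℚ ℚ.≤ tℚ h l′ → 0ℚ ℚ.≤ tℚ h h′ →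
  0ℚ ℚ.≤ tℚ x y
tℚ-rectangle {x} {y} {l} {h} {l′} {h′} l<x x<h l′<y y<h′ ll lh hl hh =
  -- The two inner calls move along the edges `x = l` and `x = h` to height `y`; the outer call then
  -- moves across in the first argument, which symmetry turns into the second.
  subst (0ℚ ℚ.≤_) (tℚ-comm y x)
    (tℚ-between y l x h l<x x<h
      (subst (0ℚ ℚ.≤_) (tℚ-comm l y) (tℚ-between l l′ y h′ l′<y y<h′ ll lh))
      (subst (0ℚ ℚ.≤_) (tℚ-comm h y) (tℚ-between h l′ y h′ l′<y y<h′ hl hh)))

turánℚ : ℚ → ℚ → ℚ → ℚ → ℚ
turánℚ p q r s =
  4ℚ ℚ.* (q ℚ.* q ℚ.- p ℚ.* r) ℚ.* (r ℚ.* r ℚ.- q ℚ.* s)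
    ℚ.- (q ℚ.* r ℚ.- p ℚ.* s) ℚ.* (q ℚ.* r ℚ.- p ℚ.* s)

-- The Turán expression with the factors A = q² · recip (q²) and B = r² · recip (r²),
-- both equal to 1, left in place, which makes tℚ-scaling a ring identity.
scaled : ℚ → ℚ → ℚ → ℚ → ℚ → ℚ → ℚ
scaled p q r s A B =
  4ℚ ℚ.* (q ℚ.* q ℚ.- (p ℚ.* r) ℚ.* A) ℚ.* (r ℚ.* r ℚ.- (q ℚ.* s) ℚ.* B)
    ℚ.- (q ℚ.* r ℚ.- p ℚ.* s ℚ.* (A ℚ.* B)) ℚ.* (q ℚ.* r ℚ.- p ℚ.* s ℚ.* (A ℚ.* B))

-- With `x = pri` and `y = qsj`, the factors distribute as `q²(1-x) = q² - prA`,
-- `r²(1-y) = r² - qsB` and `qr(1-xy) = qr - psAB`. Since `i` and `j` are free variables, no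
-- division is involved.
tℚ-scaling : ∀ p q r s i j →
  (q ℚ.* q) ℚ.* (r ℚ.* r) ℚ.* tℚ (p ℚ.* r ℚ.* i) (q ℚ.* s ℚ.* j)
    ≡ scaled p q r s (q ℚ.* q ℚ.* i) (r ℚ.* r ℚ.* j)
tℚ-scaling = solve 6 (λ p q r s i j →
  let x = p :* r :* i
      y = q :* s :* j
      A = q :* q :* i
      B = r :* r :* j in
  (q :* q) :* (r :* r) :* (con 4ℚ :* (con 1ℚ :- x) :* (con 1ℚ :- y)
      :- (con 1ℚ :- x :* y) :* (con 1ℚ :- x :* y))
  := con 4ℚ :* (q :* q :- (p :* r) :* A) :* (r :* r :- (q :* s) :* B)
      :- (q :* r :- p :* s :* (A :* B)) :* (q :* r :- p :* s :* (A :* B))) refl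
  where open +-*-Solver

scaled-1-1 : ∀ p q r s → scaled p q r s 1ℚ 1ℚ ≡ turánℚ p q r s
scaled-1-1 = solve 4 (λ p q r s →
  con 4ℚ :* (q :* q :- (p :* r) :* con 1ℚ) :* (r :* r :- (q :* s) :* con 1ℚ)
    :- (q :* r :- p :* s :* (con 1ℚ :* con 1ℚ)) :* (q :* r :- p :* s :* (con 1ℚ :* con 1ℚ))
  := con 4ℚ :* (q :* q :- p :* r) :* (r :* r :- q :* s)
    :- (q :* r :- p :* s) :* (q :* r :- p :* s)) refl
  where open +-*-Solver

0≤tℚ⇒0≤turánℚ : ∀ p q r s → q ℚ.* q ≢ 0ℚ → r ℚ.* r ≢ 0ℚ →
  0ℚ ℚ.≤ tℚ (p ℚ.* r ℚ.* recip (q ℚ.* q)) (q ℚ.* s ℚ.* recip (r ℚ.* r)) →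
  0ℚ ℚ.≤ turánℚ p q r s
0≤tℚ⇒0≤turánℚ p q r s q²≢0 r²≢0 0≤t =
  subst (0ℚ ℚ.≤_)
    (trans (tℚ-scaling p q r s (recip (q ℚ.* q)) (recip (r ℚ.* r)))
      (trans (cong₂ (scaled p q r s)
               (*-recip (q ℚ.* q) q²≢0) (*-recip (r ℚ.* r) r²≢0))
        (scaled-1-1 p q r s)))
    (0≤-* (0≤-* (0≤p² q) (0≤p² r)) 0≤t)

theorem5p2 : (a : ℕ → ℝ) (N : ℕ) → 1 ℕ.≤ N →
    (a≠0 : ∀ n → N ℕ.≤ n → a n # 0ℝ) →
    (f g : ℕ → ℝ) →
    (∀ n (N≤n : N ℕ.≤ n) →
    (g n < u a n (a≠0 n N≤n)) × (u a n (a≠0 n N≤n) < f n)) →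
    (∀ n → N ℕ.≤ n →
    (0ℝ < t (g n) (g (suc n))) × (0ℝ < t (g n) (f (suc n))) ×
    (0ℝ < t (f n) (g (suc n))) × (0ℝ < t (f n) (f (suc n)))) →
    HigherOrderTurán N a
theorem5p2 a N _ a≠0 f g g<u<f corners n N<n =
  let N≤n = ℕP.<⇒≤ N<n
      N≤1+n = ℕP.m≤n⇒m≤1+n N≤n
      gg , gf , fg , ff = corners n N≤n
  in eventually-0≤⇒0≤
    (4ℝ * (a n ² - a (n ∸ 1) * a (suc n)) * (a (suc n) ² - a n * a (suc (suc n)))
      - (a n * a (suc n) - a (n ∸ 1) * a (suc (suc n))) ²)
    (map-eventually
      (λ k ((q²≢0 , r²≢0) , ((gₙ<uₙ , uₙ<fₙ) , (gₙ₊₁<uₙ₊₁ , uₙ₊₁<fₙ₊₁))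
            , ((0<gg , 0<gf) , (0<fg , 0<ff))) →
        -- The `k`-th terms of the Turán expression, of `t` and of `u` unfold by computation to the
        -- rational formulas; `suc n ∸ 1` reduces to `n`, so the second ratio is exactly `u` at
        -- `suc n`.
        0≤tℚ⇒0≤turánℚ (seq (a (n ∸ 1)) k) (seq (a n) k)
                      (seq (a (suc n)) k) (seq (a (suc (suc n))) k) q²≢0 r²≢0
          (tℚ-rectangle gₙ<uₙ uₙ<fₙ gₙ₊₁<uₙ₊₁ uₙ₊₁<fₙ₊₁
            (ℚP.<⇒≤ 0<gg) (ℚP.<⇒≤ 0<gf) (ℚP.<⇒≤ 0<fg) (ℚP.<⇒≤ 0<ff)))
      (∩-eventually (∩-eventually (a²≢0 n N≤n) (a²≢0 (suc n) N≤1+n))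
        (∩-eventually (∩-eventually (bounds n N≤n) (bounds (suc n) N≤1+n))
          (∩-eventually
            (∩-eventually
              (<⇒eventually-< 0ℝ (t (g n) (g (suc n))) gg)
              (<⇒eventually-< 0ℝ (t (g n) (f (suc n))) gf))
            (∩-eventually
              (<⇒eventually-< 0ℝ (t (f n) (g (suc n))) fg)
              (<⇒eventually-< 0ℝ (t (f n) (f (suc n))) ff))))))
  where
  -- `u` inverts the square, so it is the terms of the square that must avoid the default value
  -- `recip 0ℚ = 0ℚ`; apartness ensures this only from some index on.
  a²≢0 : ∀ m → N ℕ.≤ m → Eventually (λ k → seq (a m ²) k ≢ 0ℚ)
  a²≢0 m N≤m = #0⇒eventually-≢0 (a m ²) (²-#0 {a m} (a≠0 m N≤m))

  bounds : ∀ m (N≤m : N ℕ.≤ m) → Eventually (λ k →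
    (seq (g m) k ℚ.< seq (u a m (a≠0 m N≤m)) k) ×
    (seq (u a m (a≠0 m N≤m)) k ℚ.< seq (f m) k))
  bounds m N≤m =
    let uₘ = u a m (a≠0 m N≤m)
        g<u , u<f = g<u<f m N≤m
    in ∩-eventually (<⇒eventually-< (g m) uₘ g<u) (<⇒eventually-< uₘ (f m) u<f)
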